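{- Let $p,q\in\mathbb{N}$ with $p<q$. (1) If $\Upsilon(p,q)\leqslant 3$ and $p/q\neq 10/17$, then $\mathcal{G}$ gives the unique best two-term underapproximation of $p/q$. (2) When $p/q=10/17$, $\mathcal{G}$ still gives the best (but not unique) two-term underapproximation of $p/q$. In particular, besides the underapproximation $1/2+1/12$ given by the greedy algorithm $\mathcal{G}$, there is exactly one other two-term underapproximation (up to the order of the two terms) equal to it, namely $1/3+1/4$. (3) Furthermore, for each integer $k\geqslant 4$, there exist $p,q\in\mathbb{N}$ with $p<q$ such that $\Upsilon(p,q)=k$ and $\mathcal{G}$ does not give the best two-term underapproximation of $p/q$.
   Context: $\mathbb{N}$ is the set of positive integers. For $p,q\in\mathbb{N}$, $\Upsilon(p,q)$ is the smallest positive integer $m$ such that $p$ divides $q+m$. For $\theta\in(0,1]$ let $G(\theta)=\lfloor 1/\theta\rfloor+1$. The greedy algorithm $\mathcal{G}$ produces the sequence $\mathcal{G}(\theta)=(a_n)_{n=1}^\infty$ defined by $a_1=G(\theta)$ and $a_m=G\left(\theta-\sum_{n=1}^{m-1}1/a_n\right)$ for $m\geqslant 2$. With $(a_n)_{n=1}^\infty=\mathcal{G}(\theta)$, $\mathcal{G}$ gives the best two-term underapproximation of $\theta$ if for all $x_1,x_2\in\mathbb{N}$ with $1/x_1+1/x_2<\theta$ we have $1/x_1+1/x_2\leqslant 1/a_1+1/a_2$ (note that always $1/a_1+1/a_2<\theta$). It is the unique best two-term underapproximation if, in addition, for positive integers $x_1\leqslant x_2$, $1/a_1+1/a_2\leqslant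 1/x_1+1/x_2<\theta$ implies $(x_1,x_2)=(a_1,a_2)$. -}

module Defs where

open import Data.Nat.Base as ℕ using (ℕ; zero; suc; NonZero)
import Data.Nat.Properties as ℕ
import Data.Nat.DivMod as ℕ
open import Data.Nat.Divisibility using (_∣_; ∣m∣n⇒∣m+n; ∣m+n∣m⇒∣n; n∣m*n; ∣-refl; ∣⇒≤)
open import Data.Integer.Base as ℤ using (+_; +[1+_]; ∣_∣)
import Data.Integer.Properties as ℤ
import Data.Integer.DivMod as ℤ
open import Data.Rational.Base as ℚ using (ℚ; mkℚ; _/_; 1/_; floor; Positive)
import Data.Rational.Properties as ℚ
open import Data.Rational.Unnormalised.Base as ℚᵘ using (mkℚᵘ)
import Data.Rational.Unnormalised.Properties as ℚᵘ
open import Data.Product.Base using (∃; _×_; _,_; proj₁)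
open import Relation.Binary.PropositionalEquality

IsΥ : ℕ → ℕ → ℕ → Set
IsΥ p q m = NonZero m × p ∣ q ℕ.+ m × (∀ k → NonZero k → p ∣ q ℕ.+ k → m ℕ.≤ k)

Υ-exists : ∀ p q .{{_ : NonZero p}} → ∃ (IsΥ p q)
Υ-exists p q = m , ℕ.>-nonZero (ℕ.m<n⇒0<n∸m r<p) , p∣q+m , least
  where
  r = q ℕ.% p
  m = p ℕ.∸ r
  d = q ℕ./ p

  r<p : r ℕ.< p
  r<p = ℕ.m%n<n q p

  q+k≡dp+[r+k] : ∀ k → q ℕ.+ k ≡ d ℕ.* p ℕ.+ (r ℕ.+ k)
  q+k≡dp+[r+k] k = begin
    q ℕ.+ k                  ≡⟨ cong (ℕ._+ k) (ℕ.m≡m%n+[m/n]*n q p) ⟩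
    r ℕ.+ d ℕ.* p ℕ.+ k      ≡⟨ cong (ℕ._+ k) (ℕ.+-comm r (d ℕ.* p)) ⟩
    d ℕ.* p ℕ.+ r ℕ.+ k      ≡⟨ ℕ.+-assoc (d ℕ.* p) r k ⟩
    d ℕ.* p ℕ.+ (r ℕ.+ k)    ∎
    where open ≡-Reasoning

  p∣q+m : p ∣ q ℕ.+ m
  p∣q+m = subst (p ∣_) (sym (q+k≡dp+[r+k] m))
    (∣m∣n⇒∣m+n (n∣m*n d)
      (subst (p ∣_) (sym (ℕ.m+[n∸m]≡n (ℕ.<⇒≤ r<p))) ∣-refl))

  least : ∀ k → NonZero k → p ∣ q ℕ.+ k → m ℕ.≤ k
  least (suc k) _ p∣q+k = ℕ.m≤n+o⇒m∸n≤o p r (∣⇒≤ {{ℕ.≢-nonZero (ℕ.m+1+n≢0 r)}} p∣r+k)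
    where
    p∣r+k : p ∣ r ℕ.+ suc k
    p∣r+k = ∣m+n∣m⇒∣n (subst (p ∣_) (q+k≡dp+[r+k] (suc k)) p∣q+k) (n∣m*n d)

Υ : ∀ p q .{{_ : NonZero p}} → ℕ
Υ p q = proj₁ (Υ-exists p q)

-- For θ > 0 the floor is nonnegative, so ∣_∣ only casts it from ℤ to ℕ.
G : (θ : ℚ) .{{_ : Positive θ}} → ℕ
G θ = suc ∣ floor ((1/ θ) {{ℚ.pos⇒nonZero θ}}) ∣

p<q⇒0<q-p : ∀ {p q} → p ℚ.< q → Positive (q ℚ.- p)
p<q⇒0<q-p {p} {q} p<q =
  ℚ.positive (subst (ℚ._< q ℚ.- p) (ℚ.+-inverseʳ p) (ℚ.+-monoˡ-< (ℚ.- p) p<q))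

1/G<θ : ∀ θ .{{_ : Positive θ}} → + 1 / G θ ℚ.< θ
1/G<θ θ@(mkℚ +[1+ n ] d _) =
  ℚ.toℚᵘ-cancel-< (ℚᵘ.<-respˡ-≃ (ℚᵘ.≃-sym (ℚ.toℚᵘ-fromℚᵘ (mkℚᵘ (+ 1) f))) (ℚᵘ.*<* lt))
  where
  f = ∣ +[1+ d ] ℤ./ +[1+ n ] ∣

  f≡ : f ≡ suc d ℕ./ suc n
  f≡ = cong ∣_∣ (ℤ.div-pos-is-/ℕ +[1+ d ] (suc n))

  lt : + 1 ℤ.* +[1+ d ] ℤ.< +[1+ n ] ℤ.* +[1+ f ]
  lt = subst₂ ℤ._<_ (sym (ℤ.*-identityˡ +[1+ d ]))
    (trans (cong (λ k → +[1+ k ] ℤ.* +[1+ n ]) (sym f≡)) (ℤ.*-comm +[1+ f ] +[1+ n ]))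
    (ℤ.n<s[n/ℕd]*d +[1+ d ] (suc n))

G-step : ∀ θ s .{{_ : Positive (θ ℚ.- s)}} → Positive (θ ℚ.- (s ℚ.+ + 1 / G (θ ℚ.- s)))
G-step θ s = subst Positive regroup (p<q⇒0<q-p (1/G<θ (θ ℚ.- s)))
  where
  t = + 1 / G (θ ℚ.- s)
  regroup : θ ℚ.- s ℚ.- t ≡ θ ℚ.- (s ℚ.+ t)
  regroup = trans (ℚ.+-assoc θ (ℚ.- s) (ℚ.- t))
    (cong (θ ℚ.+_) (sym (ℚ.neg-distrib-+ s t)))

-- Indices start at 0: greedy θ i is the term a_{i+1}, and greedySum θ i is
-- 1/a_1 + … + 1/a_{i+1}.
mutual
  greedy : (θ : ℚ) .{{_ : Positive θ}} → ℕ → ℕ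
  greedy θ zero    = G θ
  greedy θ (suc i) = G (θ ℚ.- greedySum θ i) {{greedy-remainder θ i}}

  greedySum : (θ : ℚ) .{{_ : Positive θ}} → ℕ → ℚ
  greedySum θ zero    = (+ 1 / greedy θ zero) {{greedy-nonZero θ zero}}
  greedySum θ (suc i) = greedySum θ i ℚ.+ (+ 1 / greedy θ (suc i)) {{greedy-nonZero θ (suc i)}}

  greedy-nonZero : (θ : ℚ) .{{_ : Positive θ}} (i : ℕ) → NonZero (greedy θ i)
  greedy-nonZero θ zero    = _
  greedy-nonZero θ (suc i) = _

  greedy-remainder : (θ : ℚ) .{{_ : Positive θ}} (i : ℕ) → Positive (θ ℚ.- greedySum θ i)
  greedy-remainder θ zero    = p<q⇒0<q-p (1/G<θ θ)
  greedy-remainder θ (suc i) = G-step θ (greedySum θ i) {{greedy-remainder θ i}}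

IsBestTwoTerm : (θ : ℚ) .{{_ : Positive θ}} → Set
IsBestTwoTerm θ = ∀ x₁ x₂ .{{_ : NonZero x₁}} .{{_ : NonZero x₂}} →
  + 1 / x₁ ℚ.+ + 1 / x₂ ℚ.< θ →
  + 1 / x₁ ℚ.+ + 1 / x₂ ℚ.≤ greedySum θ 1

IsUniqueBestTwoTerm : (θ : ℚ) .{{_ : Positive θ}} → Set
IsUniqueBestTwoTerm θ = IsBestTwoTerm θ ×
  (∀ x₁ x₂ .{{_ : NonZero x₁}} .{{_ : NonZero x₂}} → x₁ ℕ.≤ x₂ →
    greedySum θ 1 ℚ.≤ + 1 / x₁ ℚ.+ + 1 / x₂ →
    + 1 / x₁ ℚ.+ + 1 / x₂ ℚ.< θ →
    x₁ ≡ greedy θ 0 × x₂ ≡ greedy θ 1)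

instance
  /-positive : ∀ {p q} .{{_ : NonZero p}} .{{_ : NonZero q}} → Positive (+ p / q)
  /-positive {p} {q} = ℚ.normalize-pos p q

{-# OPTIONS --safe #-}
module Submission where

-- Let a, b be the first two greedy denominators of p/q, and write q + m = p a and
-- q a + r = m b, so that 1 ≤ r ≤ m ≤ Υ(p, q) ≤ 3.  Suppose 1/x + 1/y < p/q is at least
-- 1/a + 1/b, with a < x ≤ y.  For D = p x y − q (x + y), x = a + u and y = a + v one finds
--   p u v + m (2 a + u + v) = p a² + D   and   D a² + r u v ≤ r a²,
-- hence 1 ≤ D < r.  As (u − c) (v − c) ≥ 0 for c ≤ u, these give (c p + m) D a² ≤ m² (a + c)².
-- The case c = 1 yields p ≤ 20; together with c = 2 it also shows that a ≥ 19 is only possible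
-- for m = 3, D = 1, u = 1 and p ∈ {4, 5}, which the congruence 3 (a + 1)² ≡ 1 (mod p + 3) rules
-- out.  A finite search over the remaining cases leaves 10/17 with (x, y) = (3, 4).

module Arithmetic where

  open import Data.Nat.Base
  open import Data.Nat.Properties
  open import Data.Nat.Divisibility using (_∣_; _∣?_; divides; ∣⇒≤; ∣m⇒∣m*n; m∣m*n; ∣m∣n⇒∣m+n; ∣m+n∣m⇒∣n)
  open import Data.Nat.DivMod using (_%_; _/_; m%n<n; m≡m%n+[m/n]*n; [m+kn]%n≡m%n)
  open import Data.Nat.Tactic.RingSolver using (solve)
  open import Data.List.Base using (_∷_; [])
  open import Data.Product.Base using (_×_; _,_)
  open import Data.Sum.Base using (_⊎_; inj₁; inj₂)
  open import Data.Empty using (⊥)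
  open import Relation.Nullary.Decidable
    using (Dec; toWitness; toWitnessFalse; ¬?; _×-dec_; _⊎-dec_; _→-dec_)
  open import Relation.Nullary.Negation using (¬_; contradiction)
  open import Relation.Binary.PropositionalEquality

  -- The finite search

  Balanced : (m D p a u v : ℕ) → Set
  Balanced m D p a u v = p * (u * v) + m * (2 * a + (u + v)) ≡ p * (a * a) + D

  Exceptional : (m D p a u : ℕ) → Set
  Exceptional m D p a u = m ≡ 3 × D ≡ 1 × p ≡ 10 × a ≡ 2 × u ≡ 1

  -- The last two premises are Balanced and the gap inequality with v eliminated: Balanced makes
  -- v the quotient of p a² + D − m (2 a + u) by p u + m.
  BoundedSearch : Set
  BoundedSearch = ∀ {m} → m < 4 → ∀ {r} → r < suc m → ∀ {D} → D < r → 1 ≤ D →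
    ∀ {p} → p < 21 → m ≤ p × ¬ m ∣ p →
    ∀ {a} → a < 19 → 2 ≤ a × m ∣ p * (a * a) + r →
    ∀ {u} → u < a → 1 ≤ u →
    p * u + m ∣ p * (a * a) + D ∸ m * (2 * a + u) →
    D * (a * a) * (p * u + m) + r * u * (p * (a * a) + D ∸ m * (2 * a + u)) ≤ r * (a * a) * (p * u + m) →
    Exceptional m D p a u

  -- Each guard follows the quantifier that completes its variables, so failing branches are cut
  -- before the inner ranges open.
  bounded-search? : Dec BoundedSearch
  bounded-search? =
    allUpTo? (λ m → allUpTo? (λ r → allUpTo? (λ D → (1 ≤? D) →-dec
      allUpTo? (λ p → ((m ≤? p) ×-dec ¬? (m ∣? p)) →-dec
        allUpTo? (λ a → ((2 ≤? a) ×-dec (m ∣? p * (a * a) + r)) →-dec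
          allUpTo? (λ u → (1 ≤? u) →-dec
            (p * u + m ∣? p * (a * a) + D ∸ m * (2 * a + u)) →-dec
            (D * (a * a) * (p * u + m) + r * u * (p * (a * a) + D ∸ m * (2 * a + u)) ≤? r * (a * a) * (p * u + m)) →-dec
            ((m ≟ 3) ×-dec (D ≟ 1) ×-dec (p ≟ 10) ×-dec (a ≟ 2) ×-dec (u ≟ 1))) a) 19) 21) r) (suc m)) 4

  bounded-search : BoundedSearch
  bounded-search = toWitness {a? = bounded-search?} _

  -- Quadratic bounds

  c[u+v]≤c²+uv : ∀ {c u v} → c ≤ u → c ≤ v → c * (u + v) ≤ c * c + u * v
  c[u+v]≤c²+uv {c} c≤u c≤v with m≤n⇒∃[o]m+o≡n c≤u | m≤n⇒∃[o]m+o≡n c≤v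
  ... | i , refl | j , refl = begin
    c * (c + i + (c + j))          ≤⟨ m≤m+n _ (i * j) ⟩
    c * (c + i + (c + j)) + i * j  ≡⟨ solve (c ∷ i ∷ j ∷ []) ⟩
    c * c + (c + i) * (c + j)      ∎
    where open ≤-Reasoning

  -- Multiply `Balanced` by `m * c` and replace `c * (u + v)` by the larger `c * c + u * v`. The
  -- terms in `u * v` then gather with weight `m * (c * p + m)`, which the gap inequality times
  -- `c * p + m` absorbs. A common summand, cancelled at the end, keeps subtraction out.
  quadratic-bound : ∀ c {m D p a u v} → c ≤ u → u ≤ v → Balanced m D p a u v →
    D * (a * a) + m * (u * v) ≤ m * (a * a) →
    (c * p + m) * D * (a * a) ≤ m * m * ((a + c) * (a + c))
  quadratic-bound c {m} {D} {p} {a} {u} {v} c≤u u≤v balanced gap = +-cancelʳ-≤ (m * (c * (p * (a * a) + D))) _ _ (begin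
    (c * p + m) * D * (a * a) + m * (c * (p * (a * a) + D))
      ≡⟨ cong (λ z → (c * p + m) * D * (a * a) + m * (c * z)) balanced ⟨
    (c * p + m) * D * (a * a) + m * (c * (p * (u * v) + m * (2 * a + (u + v))))
      ≡⟨ solve (c ∷ m ∷ D ∷ p ∷ a ∷ u ∷ v ∷ []) ⟩
    (c * p + m) * D * (a * a) + m * c * p * (u * v) + m * m * c * 2 * a + m * m * (c * (u + v))
      ≤⟨ +-monoʳ-≤ _ (*-monoʳ-≤ (m * m) (c[u+v]≤c²+uv c≤u (≤-trans c≤u u≤v))) ⟩
    (c * p + m) * D * (a * a) + m * c * p * (u * v) + m * m * c * 2 * a + m * m * (c * c + u * v)
      ≡⟨ solve (c ∷ m ∷ D ∷ p ∷ a ∷ u ∷ v ∷ []) ⟩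
    (c * p + m) * (D * (a * a) + m * (u * v)) + (m * m * c * 2 * a + m * m * (c * c))
      ≤⟨ +-monoˡ-≤ _ (*-monoʳ-≤ (c * p + m) gap) ⟩
    (c * p + m) * (m * (a * a)) + (m * m * c * 2 * a + m * m * (c * c))
      ≤⟨ m≤m+n _ (m * (c * D)) ⟩
    (c * p + m) * (m * (a * a)) + (m * m * c * 2 * a + m * m * (c * c)) + m * (c * D)
      ≡⟨ solve (c ∷ m ∷ D ∷ p ∷ a ∷ []) ⟩
    m * m * ((a + c) * (a + c)) + m * (c * (p * (a * a) + D))  ∎)
    where open ≤-Reasoning

  -- The ratio (a + c) / a decreases as `a` grows, so a bound that holds at `a` also holds at each
  -- smaller positive `A`. A constraint on all large `a` becomes one numerical check.
  ratio-antitone : ∀ {A a} K L c .{{_ : NonZero A}} → A ≤ a →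
    K * (a * a) ≤ L * ((a + c) * (a + c)) → K * (A * A) ≤ L * ((A + c) * (A + c))
  ratio-antitone {A} {a} K L c A≤a bound =
    *-cancelʳ-≤ _ _ (a * a) {{m*n≢0 a a {{a≢0}} {{a≢0}}}} (begin
      K * (A * A) * (a * a)                    ≡⟨ solve (K ∷ A ∷ a ∷ []) ⟩
      (A * A) * (K * (a * a))                  ≤⟨ *-monoʳ-≤ (A * A) bound ⟩
      (A * A) * (L * ((a + c) * (a + c)))      ≡⟨ solve (A ∷ a ∷ L ∷ c ∷ []) ⟩
      L * ((A * a + A * c) * (A * a + A * c))  ≤⟨ *-monoʳ-≤ L (*-mono-≤ step step) ⟩
      L * ((A * a + a * c) * (A * a + a * c))  ≡⟨ solve (A ∷ a ∷ L ∷ c ∷ []) ⟩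
      L * ((A + c) * (A + c)) * (a * a)        ∎)
    where
    open ≤-Reasoning
    a≢0 : NonZero a
    a≢0 = >-nonZero (≤-trans (>-nonZero⁻¹ A) A≤a)
    step : A * a + A * c ≤ A * a + a * c
    step = +-monoʳ-≤ (A * a) (*-monoˡ-≤ c A≤a)

  -- Excluding `a ≥ 19` by size and by residues

  [3s²]%-periodic : ∀ N s .{{_ : NonZero N}} → (3 * (s * s)) % N ≡ (3 * ((s % N) * (s % N))) % N
  [3s²]%-periodic N s = begin
    (3 * (s * s)) % N                                ≡⟨ cong (λ z → (3 * (z * z)) % N) (m≡m%n+[m/n]*n s N) ⟩
    (3 * ((j + k * N) * (j + k * N))) % N            ≡⟨ cong (_% N) (expand j k) ⟩
    (3 * (j * j) + 3 * (2 * j * k + k * k * N) * N) % N  ≡⟨ [m+kn]%n≡m%n (3 * (j * j)) (3 * (2 * j * k + k * k * N)) N ⟩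
    (3 * (j * j)) % N                                ∎
    where
    open ≡-Reasoning
    j = s % N
    k = s / N
    expand : ∀ j k → 3 * ((j + k * N) * (j + k * N)) ≡ 3 * (j * j) + 3 * (2 * j * k + k * k * N) * N
    expand j k = solve (j ∷ k ∷ N ∷ [])

  -- For u = 1, m = 3, D = 1, completing the square turns balance into 3 (a + 1)² ≡ 1 mod p + 3.
  3s²≡1 : ∀ {p a v} → Balanced 3 1 p a 1 v → (3 * ((a + 1) * (a + 1))) % (3 + p) ≡ 1 % (3 + p)
  3s²≡1 {p} {a} {v} balanced = begin
    (3 * ((a + 1) * (a + 1))) % N          ≡⟨ [m+kn]%n≡m%n (3 * ((a + 1) * (a + 1))) v N ⟨
    (3 * ((a + 1) * (a + 1)) + v * N) % N  ≡⟨ cong (_% N) square ⟩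
    (1 + a * a * N) % N                    ≡⟨ [m+kn]%n≡m%n 1 (a * a) N ⟩
    1 % N                                  ∎
    where
    open ≡-Reasoning
    N = 3 + p
    square : 3 * ((a + 1) * (a + 1)) + v * (3 + p) ≡ 1 + a * a * (3 + p)
    square = begin
      3 * ((a + 1) * (a + 1)) + v * (3 + p)                         ≡⟨ solve (a ∷ v ∷ p ∷ []) ⟩
      p * (1 * v) + 3 * (2 * a + (1 + v)) + 3 * (a * a)             ≡⟨ cong (_+ 3 * (a * a)) balanced ⟩
      p * (a * a) + 1 + 3 * (a * a)                                 ≡⟨ solve (a ∷ p ∷ []) ⟩
      1 + a * a * (3 + p)                                           ∎

  3s²≢1 : ∀ N .{{_ : NonZero N}} → (∀ {j} → j < N → (3 * (j * j)) % N ≢ 1 % N) → ∀ s → (3 * (s * s)) % N ≢ 1 % N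
  3s²≢1 N residues s eq = residues (m%n<n s N) (trans (sym ([3s²]%-periodic N s)) eq)


  residues? : ∀ N .{{_ : NonZero N}} → Dec (∀ {j} → j < N → (3 * (j * j)) % N ≢ 1 % N)
  residues? N = allUpTo? (λ j → ¬? ((3 * (j * j)) % N ≟ 1 % N)) N

  -- The moduli 7 and 8 are `3 + p` for `p = 4` and `p = 5`. Tripled squares are 0, 3, 5, 6 modulo 7
  -- and 0, 3, 4 modulo 8.
  3s²≢1[7] : ∀ s → (3 * (s * s)) % 7 ≢ 1 % 7
  3s²≢1[7] = 3s²≢1 7 (toWitness {a? = residues? 7} _)

  3s²≢1[8] : ∀ s → (3 * (s * s)) % 8 ≢ 1 % 8
  3s²≢1[8] = 3s²≢1 8 (toWitness {a? = residues? 8} _)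

  -- The threshold 19 is the least `a` with 10 a² > 9 (a + 1)², which removes `p ≥ 7` when `m = 3`
  -- and `D = 1`. It also satisfies 11 a² > 9 (a + 2)², which forces `u = 1`.
  large-a : ∀ {m D p a u v} → 1 ≤ D → D < m → m ≤ 3 → m ≤ p → p < 21 → ¬ m ∣ p → 1 ≤ u → u ≤ v →
    Balanced m D p a u v → D * (a * a) + m * (u * v) ≤ m * (a * a) → a < 19
  large-a {m} {D} {p} {a} {u} {v} 1≤D D<m m≤3 m≤p p<21 m∤p 1≤u u≤v balanced gap = ≰⇒> impossible
    where
    bound : ∀ c → c ≤ u → 19 ≤ a → (c * p + m) * D * (19 * 19) ≤ m * m * ((19 + c) * (19 + c))
    bound c c≤u 19≤a = ratio-antitone ((c * p + m) * D) (m * m) c 19≤a (quadratic-bound c {m} {D} {p} {a} c≤u u≤v balanced gap)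

    small-p : 19 ≤ a → m ≡ 3 × D ≡ 1 × (p ≡ 4 ⊎ p ≡ 5)
    small-p 19≤a = toWitness {a? = cases?} _ (s≤s m≤3) D<m p<21 (1≤D , m≤p , m∤p) (bound 1 1≤u 19≤a)
      where
      cases? : Dec (∀ {m} → m < 4 → ∀ {D} → D < m → ∀ {p} → p < 21 → 1 ≤ D × m ≤ p × ¬ m ∣ p →
        (1 * p + m) * D * (19 * 19) ≤ m * m * ((19 + 1) * (19 + 1)) → m ≡ 3 × D ≡ 1 × (p ≡ 4 ⊎ p ≡ 5))
      cases? = allUpTo? (λ m → allUpTo? (λ D → allUpTo? (λ p →
        ((1 ≤? D) ×-dec (m ≤? p) ×-dec ¬? (m ∣? p)) →-dec
        ((1 * p + m) * D * (19 * 19) ≤? m * m * ((19 + 1) * (19 + 1))) →-dec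
        ((m ≟ 3) ×-dec (D ≟ 1) ×-dec ((p ≟ 4) ⊎-dec (p ≟ 5)))) 21) m) 4

    u≡1 : 19 ≤ a → m ≡ 3 → D ≡ 1 → 4 ≤ p → u ≡ 1
    u≡1 19≤a refl refl 4≤p with m≤n⇒m<n∨m≡n 1≤u
    ... | inj₂ 1≡u = sym 1≡u
    -- For `c = 2` and `p ≥ 4` the left side is at least 11 * 361 = 3971, against 9 * 441 = 3969.
    ... | inj₁ 2≤u = contradiction (≤-trans weaken (bound 2 2≤u 19≤a)) (toWitnessFalse {a? = 3971 ≤? 3969} _)
      where
      weaken : 3971 ≤ (2 * p + 3) * 1 * 361
      weaken = *-monoˡ-≤ 361 (*-monoˡ-≤ 1 (+-monoˡ-≤ 3 (*-monoʳ-≤ 2 4≤p)))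

    impossible : ¬ 19 ≤ a
    impossible 19≤a = residual (small-p 19≤a)
      where
      residual : m ≡ 3 × D ≡ 1 × (p ≡ 4 ⊎ p ≡ 5) → ⊥
      residual (refl , refl , inj₁ refl) with u≡1 19≤a refl refl ≤-refl
      ... | refl = 3s²≢1[7] (a + 1) (3s²≡1 {4} {a} {v} balanced)
      residual (refl , refl , inj₂ refl) with u≡1 19≤a refl refl (n≤1+n 4)
      ... | refl = 3s²≢1[8] (a + 1) (3s²≡1 {5} {a} {v} balanced)

  -- Reduction to the finite search

  exceptional : ∀ {m r D p a u v} → m ≤ 3 → r ≤ m → D < r → 1 ≤ D → m ≤ p → ¬ m ∣ p →
    2 ≤ a → m ∣ p * (a * a) + r → 1 ≤ u → u ≤ v →
    Balanced m D p a u v → D * (a * a) + r * (u * v) ≤ r * (a * a) →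
    m ≡ 3 × p ≡ 10 × a ≡ 2 × u ≡ 1 × v ≡ 2
  exceptional {m} {r} {D} {p} {a} {u} {v} m≤3 r≤m D<r 1≤D m≤p m∤p 2≤a m∣paa+r 1≤u u≤v balanced gap =
    finish (bounded-search (s≤s m≤3) (s≤s r≤m) D<r 1≤D p<21 (m≤p , m∤p) a<19 (2≤a , m∣paa+r) u<a 1≤u
      (divides v N≡vK) scaledGap)
    where
    K = p * u + m
    N = p * (a * a) + D ∸ m * (2 * a + u)

    1≤a : 1 ≤ a
    1≤a = <⇒≤ 2≤a

    uv<aa : u * v < a * a
    uv<aa = *-cancelˡ-< r _ _ (<-≤-trans (m<n+m (r * (u * v)) (*-mono-≤ 1≤D (*-mono-≤ 1≤a 1≤a))) gap)

    gap′ : D * (a * a) + m * (u * v) ≤ m * (a * a)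
    -- Since `u * v < a * a`, raising `r` to `m` preserves the gap inequality and gives the form
    -- that `quadratic-bound` takes.
    gap′ with m≤n⇒∃[o]m+o≡n r≤m
    ... | o , refl = begin
      D * (a * a) + (r + o) * (u * v)            ≡⟨ solve (D ∷ a ∷ r ∷ o ∷ u ∷ v ∷ []) ⟩
      D * (a * a) + r * (u * v) + o * (u * v)    ≤⟨ +-mono-≤ gap (*-monoʳ-≤ o (<⇒≤ uv<aa)) ⟩
      r * (a * a) + o * (a * a)                  ≡⟨ *-distribʳ-+ (a * a) r o ⟨
      (r + o) * (a * a)                          ∎
      where
      open ≤-Reasoning

    u<a : u < a
    u<a = ≰⇒> λ a≤u → <⇒≱ uv<aa (*-mono-≤ a≤u (≤-trans a≤u u≤v))

    p<21 : p < 21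
    -- At `a = 2`, `c = 1` the bound reads 4 (p + m) D ≤ 9 m². The right side is at most 81, while
    -- `p ≥ 21` makes the left at least 84.
    p<21 = ≰⇒> λ 21≤p → <⇒≱ (bounded 21≤p) (ratio-antitone ((1 * p + m) * D) (m * m) 1 2≤a (quadratic-bound 1 {m} {D} {p} {a} 1≤u u≤v balanced gap′))
      where
      bounded : 21 ≤ p → m * m * (3 * 3) < (1 * p + m) * D * (2 * 2)
      bounded 21≤p = begin-strict
        m * m * 9                <⟨ s≤s (*-monoˡ-≤ 9 (*-mono-≤ m≤3 m≤3)) ⟩
        82                       ≤⟨ m≤m+n 82 2 ⟩
        (1 * 21 + 0) * 1 * 4     ≤⟨ *-monoˡ-≤ 4 (*-mono-≤ (+-mono-≤ (*-monoʳ-≤ 1 21≤p) (z≤n {m})) 1≤D) ⟩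
        (1 * p + m) * D * 4      ∎
        where open ≤-Reasoning

    a<19 : a < 19
    a<19 = large-a 1≤D (<-≤-trans D<r r≤m) m≤3 m≤p p<21 m∤p 1≤u u≤v balanced gap′

    N≡vK : N ≡ v * K
    N≡vK = begin
      p * (a * a) + D ∸ m * (2 * a + u)                          ≡⟨ cong (_∸ m * (2 * a + u)) balanced ⟨
      p * (u * v) + m * (2 * a + (u + v)) ∸ m * (2 * a + u)      ≡⟨ cong (_∸ m * (2 * a + u)) regroup ⟩
      v * K + m * (2 * a + u) ∸ m * (2 * a + u)                  ≡⟨ m+n∸n≡m (v * K) (m * (2 * a + u)) ⟩
      v * K                                                      ∎
      where
      open ≡-Reasoning
      regroup : p * (u * v) + m * (2 * a + (u + v)) ≡ v * (p * u + m) + m * (2 * a + u)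
      regroup = solve (p ∷ u ∷ v ∷ m ∷ a ∷ [])

    scaledGap : D * (a * a) * K + r * u * N ≤ r * (a * a) * K
    scaledGap = begin
      D * (a * a) * K + r * u * N        ≡⟨ cong (λ n → D * (a * a) * K + r * u * n) N≡vK ⟩
      D * (a * a) * K + r * u * (v * K)  ≡⟨ factor K ⟩
      (D * (a * a) + r * (u * v)) * K    ≤⟨ *-monoˡ-≤ K gap ⟩
      r * (a * a) * K                    ∎
      where
      open ≤-Reasoning
      factor : ∀ k → D * (a * a) * k + r * u * (v * k) ≡ (D * (a * a) + r * (u * v)) * k
      factor k = solve (D ∷ a ∷ r ∷ u ∷ v ∷ k ∷ [])

    finish : Exceptional m D p a u → m ≡ 3 × p ≡ 10 × a ≡ 2 × u ≡ 1 × v ≡ 2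
    -- In the surviving case `K` is 13 and `N` is 26.
    finish (refl , refl , refl , refl , refl) = refl , refl , refl , refl ,
      *-cancelʳ-≡ v 2 13 (sym N≡vK)

  -- Greedy pairs and their challengers

  record GreedyPair (p q a b : ℕ) : Set where
    field
      -- Denominators are cleared: `q < p * n` is 1/n < p/q, and `(a + n) * q < p * (a * n)` is 1/a
      -- + 1/n < p/q. Minimality replaces the floor of the greedy definition.
      first-under  : q < p * a
      first-least  : ∀ n → q < p * n → a ≤ n
      second-under : (a + b) * q < p * (a * b)
      second-least : ∀ n → (a + n) * q < p * (a * n) → b ≤ n

  -- The predecessor of `b` fails the inequality, which limits the overshoot. This yields `m ≤ p`
  -- and `r ≤ m` in `Deviation`.
  least⇒≤step : ∀ {k m b} → k < m * b → (∀ n → k < m * n → b ≤ n) → m * b ≤ k + m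
  least⇒≤step {k} {m} {zero}  _ _     rewrite *-zeroʳ m = z≤n
  least⇒≤step {k} {m} {suc b} _ least = begin
    m * suc b  ≡⟨ *-suc m b ⟩
    m + m * b  ≤⟨ +-monoʳ-≤ m (≮⇒≥ (λ k<mb → 1+n≰n (least b k<mb))) ⟩
    m + k      ≡⟨ +-comm m k ⟩
    k + m      ∎
    where open ≤-Reasoning

  module Deviation {p q a b x y : ℕ} .{{_ : NonZero y}} (pair : GreedyPair p q a b) (p<q : p < q) (pa≤q+3 : p * a ≤ q + 3)
    (a<x : a < x) (x≤y : x ≤ y)
    (beats : (a + b) * (x * y) ≤ (x + y) * (a * b)) (under : (x + y) * q < p * (x * y)) where

    open GreedyPair pair

    -- The fractions m/(q a), r/(q a b) and D/(q x y) are what p/q leaves after 1/a, after 1/a + 1/b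
    -- and after 1/x + 1/y. The hypotheses make every truncated subtraction exact.
    m r D u v : ℕ
    m = p * a ∸ q
    r = m * b ∸ q * a
    D = p * (x * y) ∸ (x + y) * q
    u = x ∸ a
    v = y ∸ a

    q+m≡pa : q + m ≡ p * a
    q+m≡pa = m+[n∸m]≡n (<⇒≤ first-under)

    pan≡qn+mn : ∀ n → p * (a * n) ≡ n * q + m * n
    pan≡qn+mn n = begin
      p * (a * n)    ≡⟨ *-assoc p a n ⟨
      p * a * n      ≡⟨ cong (_* n) q+m≡pa ⟨
      (q + m) * n    ≡⟨ *-distribʳ-+ n q m ⟩
      q * n + m * n  ≡⟨ cong (_+ m * n) (*-comm q n) ⟩
      n * q + m * n  ∎
      where open ≡-Reasoning

    [a+n]q≡nq+qa : ∀ n → (a + n) * q ≡ n * q + q * a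
    [a+n]q≡nq+qa n = solve (a ∷ n ∷ q ∷ [])

    qa<mb : q * a < m * b
    qa<mb = +-cancelˡ-< (b * q) _ _ (subst₂ _<_ ([a+n]q≡nq+qa b) (pan≡qn+mn b) second-under)

    qa<mn⇒b≤n : ∀ n → q * a < m * n → b ≤ n
    qa<mn⇒b≤n n qa<mn = second-least n
      (subst₂ _<_ (sym ([a+n]q≡nq+qa n)) (sym (pan≡qn+mn n)) (+-monoʳ-< (n * q) qa<mn))

    qa+r≡mb : q * a + r ≡ m * b
    qa+r≡mb = m+[n∸m]≡n (<⇒≤ qa<mb)

    [x+y]q+D≡pxy : (x + y) * q + D ≡ p * (x * y)
    [x+y]q+D≡pxy = m+[n∸m]≡n (<⇒≤ under)

    a+u≡x : a + u ≡ x
    a+u≡x = m+[n∸m]≡n (<⇒≤ a<x)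

    a+v≡y : a + v ≡ y
    a+v≡y = m+[n∸m]≡n (<⇒≤ (<-≤-trans a<x x≤y))

    m≤p : m ≤ p
    m≤p = +-cancelˡ-≤ q _ _ (subst (_≤ q + p) (sym q+m≡pa) (least⇒≤step {q} {p} {a} first-under first-least))

    m≤3 : m ≤ 3
    m≤3 = +-cancelˡ-≤ q _ _ (subst (_≤ q + 3) (sym q+m≡pa) pa≤q+3)

    r≤m : r ≤ m
    r≤m = +-cancelˡ-≤ (q * a) _ _ (subst (_≤ q * a + m) (sym qa+r≡mb) (least⇒≤step {q * a} {m} {b} qa<mb qa<mn⇒b≤n))

    1≤D : 1 ≤ D
    1≤D = m<n⇒0<n∸m under

    1≤u : 1 ≤ u
    1≤u = m<n⇒0<n∸m a<x

    u≤v : u ≤ v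
    u≤v = ∸-monoˡ-≤ a x≤y

    2≤a : 2 ≤ a
    2≤a = ≰⇒> λ a≤1 → <-asym p<q (<-≤-trans first-under (subst (p * a ≤_) (*-identityʳ p) (*-monoʳ-≤ p a≤1)))

    xy+aa≡uv+a[x+y] : x * y + a * a ≡ u * v + a * (x + y)
    xy+aa≡uv+a[x+y] = subst₂ (λ x y → x * y + a * a ≡ u * v + a * (x + y)) a+u≡x a+v≡y (identity u v)
      where
      identity : ∀ u v → (a + u) * (a + v) + a * a ≡ u * v + a * (a + u + (a + v))
      identity u v = solve (a ∷ u ∷ v ∷ [])

    -- Expand `D` with x y = u v + a (x + y) - a²: the coefficient of `x + y` becomes p a - q = m.
    balanced : Balanced m D p a u v
    balanced = +-cancelʳ-≡ ((x + y) * q) _ _ (begin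
      p * (u * v) + m * (2 * a + (u + v)) + (x + y) * q
        ≡⟨ cong (λ s → p * (u * v) + m * s + (x + y) * q) 2a+u+v≡x+y ⟩
      p * (u * v) + m * (x + y) + (x + y) * q
        ≡⟨ collect m (x + y) (u * v) ⟩
      p * (u * v) + (q + m) * (x + y)
        ≡⟨ cong (λ s → p * (u * v) + s * (x + y)) q+m≡pa ⟩
      p * (u * v) + p * a * (x + y)
        ≡⟨ factor (u * v) (x + y) ⟩
      p * (u * v + a * (x + y))
        ≡⟨ cong (p *_) xy+aa≡uv+a[x+y] ⟨
      p * (x * y + a * a)
        ≡⟨ trans (*-distribˡ-+ p (x * y) (a * a)) (+-comm (p * (x * y)) (p * (a * a))) ⟩
      p * (a * a) + p * (x * y)
        ≡⟨ cong (p * (a * a) +_) (trans (sym [x+y]q+D≡pxy) (+-comm ((x + y) * q) D)) ⟩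
      p * (a * a) + (D + (x + y) * q)
        ≡⟨ +-assoc (p * (a * a)) D ((x + y) * q) ⟨
      p * (a * a) + D + (x + y) * q  ∎)
      where
      open ≡-Reasoning
      2a+u+v≡x+y : 2 * a + (u + v) ≡ x + y
      2a+u+v≡x+y = trans (identity u v) (cong₂ _+_ a+u≡x a+v≡y)
        where
        identity : ∀ u v → 2 * a + (u + v) ≡ (a + u) + (a + v)
        identity u v = solve (a ∷ u ∷ v ∷ [])
      collect : ∀ m s w → p * w + m * s + s * q ≡ p * w + (q + m) * s
      collect m s w = solve (p ∷ q ∷ m ∷ s ∷ w ∷ [])
      factor : ∀ w s → p * w + p * a * s ≡ p * (w + a * s)
      factor w s = solve (p ∷ a ∷ w ∷ s ∷ [])

    -- A challenger that does at least as well leaves no larger remainder; the factor `q` common to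
    -- both denominators drops out.
    Dab≤rxy : D * (a * b) ≤ r * (x * y)
    Dab≤rxy = +-cancelʳ-≤ ((x + y) * q * (a * b)) _ _ (begin
      D * (a * b) + (x + y) * q * (a * b)     ≡⟨ regroup D ((x + y) * q) (a * b) ⟩
      ((x + y) * q + D) * (a * b)             ≡⟨ cong (_* (a * b)) [x+y]q+D≡pxy ⟩
      p * (x * y) * (a * b)                   ≡⟨ swap (x * y) (a * b) ⟩
      p * (a * b) * (x * y)                   ≡⟨ cong (_* (x * y)) pab≡ ⟩
      (r + (a + b) * q) * (x * y)             ≡⟨ spread r (a + b) (x * y) ⟩
      r * (x * y) + q * ((a + b) * (x * y))   ≤⟨ +-monoʳ-≤ (r * (x * y)) (*-monoʳ-≤ q beats) ⟩
      r * (x * y) + q * ((x + y) * (a * b))   ≡⟨ cong (r * (x * y) +_) (pull (x + y) (a * b)) ⟩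
      r * (x * y) + (x + y) * q * (a * b)     ∎)
      where
      open ≤-Reasoning
      pab≡ : p * (a * b) ≡ r + (a + b) * q
      pab≡ = begin-equality
        p * (a * b)              ≡⟨ pan≡qn+mn b ⟩
        b * q + m * b            ≡⟨ cong (b * q +_) qa+r≡mb ⟨
        b * q + (q * a + r)      ≡⟨ +-assoc (b * q) (q * a) r ⟨
        b * q + q * a + r        ≡⟨ cong (_+ r) ([a+n]q≡nq+qa b) ⟨
        (a + b) * q + r          ≡⟨ +-comm ((a + b) * q) r ⟩
        r + (a + b) * q          ∎
      regroup : ∀ d s w → d * w + s * w ≡ (s + d) * w
      regroup d s w = solve (d ∷ s ∷ w ∷ [])
      swap : ∀ w z → p * w * z ≡ p * z * w
      swap w z = solve (p ∷ w ∷ z ∷ [])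
      spread : ∀ r s w → (r + s * q) * w ≡ r * w + q * (s * w)
      spread r s w = solve (r ∷ s ∷ q ∷ w ∷ [])
      pull : ∀ s w → q * (s * w) ≡ s * q * w
      pull s w = solve (q ∷ s ∷ w ∷ [])

    -- This is `D * a` computed from `p * a = q + m`. It trades `x * y` for `u * v`, so that the
    -- remainders can be compared through `u * v` and `a * a`.
    mxy+quv≡qaa+Da : m * (x * y) + q * (u * v) ≡ q * (a * a) + D * a
    mxy+quv≡qaa+Da = +-cancelʳ-≡ (a * ((x + y) * q)) _ _ (begin
      m * (x * y) + q * (u * v) + a * ((x + y) * q)  ≡⟨ regroup m (x * y) (u * v) (x + y) ⟩
      m * (x * y) + q * (u * v + a * (x + y))        ≡⟨ cong (λ s → m * (x * y) + q * s) xy+aa≡uv+a[x+y] ⟨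
      m * (x * y) + q * (x * y + a * a)              ≡⟨ regroup′ m (x * y) ⟩
      q * (a * a) + (q + m) * (x * y)                ≡⟨ cong (λ s → q * (a * a) + s * (x * y)) q+m≡pa ⟩
      q * (a * a) + p * a * (x * y)                  ≡⟨ pull (x * y) ⟩
      q * (a * a) + a * (p * (x * y))                ≡⟨ cong (λ s → q * (a * a) + a * s) [x+y]q+D≡pxy ⟨
      q * (a * a) + a * ((x + y) * q + D)            ≡⟨ spread D ((x + y) * q) ⟩
      q * (a * a) + D * a + a * ((x + y) * q)        ∎)
      where
      open ≡-Reasoning
      regroup : ∀ m w z s → m * w + q * z + a * (s * q) ≡ m * w + q * (z + a * s)
      regroup m w z s = solve (m ∷ w ∷ z ∷ s ∷ q ∷ a ∷ [])
      regroup′ : ∀ m w → m * w + q * (w + a * a) ≡ q * (a * a) + (q + m) * w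
      regroup′ m w = solve (m ∷ w ∷ q ∷ a ∷ [])
      pull : ∀ w → q * (a * a) + p * a * w ≡ q * (a * a) + a * (p * w)
      pull w = solve (q ∷ a ∷ p ∷ w ∷ [])
      spread : ∀ d s → q * (a * a) + a * (s + d) ≡ q * (a * a) + d * a + a * s
      spread d s = solve (q ∷ a ∷ d ∷ s ∷ [])

    -- Multiply `Dab≤rxy` by `m`, replace `m * b` by `q * a + r`, and rewrite `m * (x * y)` with the
    -- preceding identity. The terms `D * a * r` cancel, then the factor `q`.
    gap : D * (a * a) + r * (u * v) ≤ r * (a * a)
    gap = *-cancelˡ-≤ q {{>-nonZero (≤-trans (s≤s z≤n) p<q)}} (+-cancelʳ-≤ (D * a * r) _ _ (begin
      q * (D * (a * a) + r * (u * v)) + D * a * r    ≡⟨ regroup D r (u * v) ⟩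
      D * a * (q * a + r) + r * (q * (u * v))        ≡⟨ cong (λ s → D * a * s + r * (q * (u * v))) qa+r≡mb ⟩
      D * a * (m * b) + r * (q * (u * v))            ≡⟨ cong (_+ r * (q * (u * v))) (pull D m) ⟩
      m * (D * (a * b)) + r * (q * (u * v))          ≤⟨ +-monoˡ-≤ _ (*-monoʳ-≤ m Dab≤rxy) ⟩
      m * (r * (x * y)) + r * (q * (u * v))          ≡⟨ factor m r (x * y) (q * (u * v)) ⟩
      r * (m * (x * y) + q * (u * v))                ≡⟨ cong (r *_) mxy+quv≡qaa+Da ⟩
      r * (q * (a * a) + D * a)                      ≡⟨ spread D r ⟩
      q * (r * (a * a)) + D * a * r                  ∎))
      where
      open ≤-Reasoning
      regroup : ∀ d r w → q * (d * (a * a) + r * w) + d * a * r ≡ d * a * (q * a + r) + r * (q * w)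
      regroup d r w = solve (d ∷ r ∷ w ∷ q ∷ a ∷ [])
      pull : ∀ d m → d * a * (m * b) ≡ m * (d * (a * b))
      pull d m = solve (d ∷ m ∷ a ∷ b ∷ [])
      factor : ∀ m r w z → m * (r * w) + r * z ≡ r * (m * w + z)
      factor m r w z = solve (m ∷ r ∷ w ∷ z ∷ [])
      spread : ∀ d r → r * (q * (a * a) + d * a) ≡ q * (r * (a * a)) + d * a * r
      spread d r = solve (d ∷ r ∷ q ∷ a ∷ [])

    1≤r : 1 ≤ r
    1≤r = m<n⇒0<n∸m qa<mb

    D<r : D < r
    D<r = *-cancelʳ-< (a * a) D r (<-≤-trans (m<m+n (D * (a * a)) (*-mono-≤ 1≤r (*-mono-≤ 1≤u (≤-trans 1≤u u≤v)))) gap)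

    -- Otherwise `balanced` would make `m` divide `D`, although 0 < D < r ≤ m.
    m∤p : ¬ m ∣ p
    m∤p m∣p = <⇒≱ (<-≤-trans D<r r≤m) (∣⇒≤ {{>-nonZero 1≤D}} m∣D)
      where
      m∣D : m ∣ D
      m∣D = ∣m+n∣m⇒∣n
        (subst (m ∣_) balanced (∣m∣n⇒∣m+n (∣m⇒∣m*n (u * v) m∣p) (m∣m*n (2 * a + (u + v)))))
        (∣m⇒∣m*n (a * a) m∣p)

    -- This retains the integrality of `b` for the search, which does not range over `b`.
    m∣paa+r : m ∣ p * (a * a) + r
    m∣paa+r = subst (m ∣_) (sym paa+r≡) (m∣m*n (b + a))
      where
      open ≡-Reasoning
      paa+r≡ : p * (a * a) + r ≡ m * (b + a)
      paa+r≡ = begin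
        p * (a * a) + r        ≡⟨ cong (_+ r) (pan≡qn+mn a) ⟩
        a * q + m * a + r      ≡⟨ regroup m r ⟩
        q * a + r + m * a      ≡⟨ cong (_+ m * a) qa+r≡mb ⟩
        m * b + m * a          ≡⟨ *-distribˡ-+ m b a ⟨
        m * (b + a)            ∎
        where
        regroup : ∀ m r → a * q + m * a + r ≡ q * a + r + m * a
        regroup m r = solve (m ∷ r ∷ a ∷ q ∷ [])

    deviation : p ≡ 10 × q ≡ 17 × x ≡ 3 × y ≡ 4
    deviation = conclude (exceptional m≤3 r≤m D<r 1≤D m≤p m∤p 2≤a m∣paa+r 1≤u u≤v balanced gap)
      where
      conclude : m ≡ 3 × p ≡ 10 × a ≡ 2 × u ≡ 1 × v ≡ 2 → p ≡ 10 × q ≡ 17 × x ≡ 3 × y ≡ 4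
      conclude (m≡3 , p≡10 , a≡2 , u≡1 , v≡2) =
        p≡10 ,
        +-cancelʳ-≡ 3 q 17 (trans (cong (q +_) (sym m≡3)) (trans q+m≡pa (cong₂ _*_ p≡10 a≡2))) ,
        trans (sym a+u≡x) (cong₂ _+_ a≡2 u≡1) ,
        trans (sym a+v≡y) (cong₂ _+_ a≡2 v≡2)

  [x+y]q<pxy⇒q<px : ∀ {p q x y} → (x + y) * q < p * (x * y) → q < p * x
  [x+y]q<pxy⇒q<px {p} {q} {x} {y} under = *-cancelʳ-< y q (p * x) (begin-strict
    q * y        ≡⟨ *-comm q y ⟩
    y * q        ≤⟨ *-monoˡ-≤ q (m≤n+m y x) ⟩
    (x + y) * q  <⟨ under ⟩
    p * (x * y)  ≡⟨ *-assoc p x y ⟨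
    p * x * y    ∎)
    where open ≤-Reasoning

  -- As 1/x alone lies below p/q, minimality gives `a ≤ x`. Strict inequality is the situation of
  -- `Deviation`; for `x = a` the second terms compare directly.
  dichotomy : ∀ {p q a b x y} .{{_ : NonZero x}} .{{_ : NonZero y}} → GreedyPair p q a b → p < q → p * a ≤ q + 3 → x ≤ y →
    (a + b) * (x * y) ≤ (x + y) * (a * b) → (x + y) * q < p * (x * y) →
    (x ≡ a × y ≡ b) ⊎ (p ≡ 10 × q ≡ 17 × x ≡ 3 × y ≡ 4)
  dichotomy {p} {q} {a} {b} {x} {y} pair p<q pa≤q+3 x≤y beats under
    with m≤n⇒m<n∨m≡n (GreedyPair.first-least pair x ([x+y]q<pxy⇒q<px {p} {q} {x} {y} under))
  ... | inj₁ a<x = inj₂ (Deviation.deviation pair p<q pa≤q+3 a<x x≤y beats under)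
  ... | inj₂ refl = inj₁ (refl , ≤-antisym y≤b (GreedyPair.second-least pair y under))
    where
    y≤b : y ≤ b
    y≤b = *-cancelˡ-≤ (a * a) {{m*n≢0 a a}} (+-cancelʳ-≤ (a * (b * y)) _ _ (begin
      a * a * y + a * (b * y)  ≡⟨ solve (a ∷ b ∷ y ∷ []) ⟩
      (a + b) * (a * y)        ≤⟨ beats ⟩
      (a + y) * (a * b)        ≡⟨ solve (a ∷ b ∷ y ∷ []) ⟩
      a * a * b + a * (b * y)  ∎))
      where open ≤-Reasoning

open Arithmetic using (GreedyPair; dichotomy)

open import Defs
open import Data.Nat.Base using (ℕ; NonZero; _≤_; _<_)
open import Data.Integer.Base using (+_)
open import Data.Rational.Base as ℚ using (_/_; _+_)
open import Data.Product.Base using (Σ-syntax; ∃-syntax; _×_)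
open import Function.Bundles using (_⇔_)
open import Relation.Nullary.Negation.Core using (¬_)
open import Relation.Binary.PropositionalEquality.Core using (_≡_; _≢_)

open import Data.Nat.Base as ℕ using (zero; suc; z≤n; s≤s)
import Data.Nat.Properties as ℕ
import Data.Nat.DivMod as ℕ
open import Data.Nat.Divisibility using (divides)
open import Data.Nat.Tactic.RingSolver using (solve)
open import Data.Integer.Base as ℤ using (+[1+_]; ∣_∣; +<+)
import Data.Integer.Properties as ℤ
import Data.Integer.DivMod as ℤ
open import Data.List.Base using (_∷_; [])
open import Data.Rational.Base using (ℚ; mkℚ; Positive)
import Data.Rational.Properties as ℚ
open import Data.Rational.Unnormalised.Base as ℚᵘ using (mkℚᵘ)
import Data.Rational.Unnormalised.Properties as ℚᵘ
open import Data.Product.Base using (_,_; proj₁)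
open import Data.Sum.Base as Sum using (_⊎_; inj₁; inj₂; [_,_]′)
open import Data.Unit.Base using (tt)
open import Function.Base using (id)
open import Function.Bundles using (mk⇔)
open import Relation.Nullary.Decidable using (toWitness; _×-dec_; _⊎-dec_; _→-dec_)
open import Relation.Nullary.Negation.Core using (contradiction)
open import Relation.Binary.PropositionalEquality
  using (refl; sym; trans; cong; cong₂; subst; subst₂; module ≡-Reasoning)

-- From rational inequalities to natural numbers

/-cancel-< : ∀ p q r s .{{_ : NonZero q}} .{{_ : NonZero s}} → + p / q ℚ.< + r / s → p ℕ.* s < r ℕ.* q
-- `_/_` reduces to lowest terms, whereas unnormalised fractions keep the given numerator and
-- denominator and are ordered by cross-multiplication.
/-cancel-< p (suc q) r (suc s) lt = ℤ.drop‿+<+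
  (subst₂ ℤ._<_ (sym (ℤ.pos-* p (suc s))) (sym (ℤ.pos-* r (suc q))) (ℚᵘ.drop-*<*
    (ℚᵘ.<-respˡ-≃ (ℚ.toℚᵘ-fromℚᵘ (mkℚᵘ (+ p) q)) (ℚᵘ.<-respʳ-≃ (ℚ.toℚᵘ-fromℚᵘ (mkℚᵘ (+ r) s)) (ℚ.toℚᵘ-mono-< lt)))))

/-mono-< : ∀ p q r s .{{_ : NonZero q}} .{{_ : NonZero s}} → p ℕ.* s < r ℕ.* q → + p / q ℚ.< + r / s
/-mono-< p (suc q) r (suc s) lt = ℚ.toℚᵘ-cancel-<
  (ℚᵘ.<-respˡ-≃ (ℚᵘ.≃-sym (ℚ.toℚᵘ-fromℚᵘ (mkℚᵘ (+ p) q))) (ℚᵘ.<-respʳ-≃ (ℚᵘ.≃-sym (ℚ.toℚᵘ-fromℚᵘ (mkℚᵘ (+ r) s)))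
    (ℚᵘ.*<* (subst₂ ℤ._<_ (ℤ.pos-* p (suc s)) (ℤ.pos-* r (suc q)) (+<+ lt)))))

/-cancel-≤ : ∀ p q r s .{{_ : NonZero q}} .{{_ : NonZero s}} → + p / q ℚ.≤ + r / s → p ℕ.* s ≤ r ℕ.* q
/-cancel-≤ p q r s le = ℕ.≮⇒≥ (λ lt → ℚ.<-irrefl refl (ℚ.<-≤-trans (/-mono-< r s p q lt) le))

unit-fractions-sum : ∀ x y .{{_ : NonZero x}} .{{_ : NonZero y}} →
  + 1 / x + + 1 / y ≡ (+ (x ℕ.+ y) / (x ℕ.* y)) {{ℕ.m*n≢0 x y}}
unit-fractions-sum (suc x) (suc y) = ℚ.toℚᵘ-injective (begin
  ℚ.toℚᵘ (+ 1 / suc x + + 1 / suc y)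
    ≈⟨ ℚ.toℚᵘ-homo-+ (+ 1 / suc x) (+ 1 / suc y) ⟩
  ℚ.toℚᵘ (+ 1 / suc x) ℚᵘ.+ ℚ.toℚᵘ (+ 1 / suc y)
    ≈⟨ ℚᵘ.+-cong (ℚ.toℚᵘ-fromℚᵘ (mkℚᵘ (+ 1) x)) (ℚ.toℚᵘ-fromℚᵘ (mkℚᵘ (+ 1) y)) ⟩
  mkℚᵘ (+ 1) x ℚᵘ.+ mkℚᵘ (+ 1) y
    ≡⟨ cong (λ n → mkℚᵘ n (y ℕ.+ x ℕ.* suc y)) numerator ⟩
  mkℚᵘ (+ (suc x ℕ.+ suc y)) (y ℕ.+ x ℕ.* suc y)
    ≈⟨ ℚ.toℚᵘ-fromℚᵘ _ ⟨
  ℚ.toℚᵘ (+ (suc x ℕ.+ suc y) / (suc x ℕ.* suc y))  ∎)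
  where
  open ℚᵘ.≃-Reasoning
  numerator : + 1 ℤ.* +[1+ y ] ℤ.+ + 1 ℤ.* +[1+ x ] ≡ + (suc x ℕ.+ suc y)
  numerator = trans (cong₂ ℤ._+_ (ℤ.*-identityˡ +[1+ y ]) (ℤ.*-identityˡ +[1+ x ])) (cong +_ (ℕ.+-comm (suc y) (suc x)))

sum<⇒ : ∀ x y p q .{{_ : NonZero x}} .{{_ : NonZero y}} .{{_ : NonZero q}} →
  + 1 / x + + 1 / y ℚ.< + p / q → (x ℕ.+ y) ℕ.* q < p ℕ.* (x ℕ.* y)
sum<⇒ x y p q lt = /-cancel-< (x ℕ.+ y) (x ℕ.* y) p q {{ℕ.m*n≢0 x y}} (subst (ℚ._< + p / q) (unit-fractions-sum x y) lt)

sum<⇐ : ∀ x y p q .{{_ : NonZero x}} .{{_ : NonZero y}} .{{_ : NonZero q}} →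
  (x ℕ.+ y) ℕ.* q < p ℕ.* (x ℕ.* y) → + 1 / x + + 1 / y ℚ.< + p / q
sum<⇐ x y p q lt = subst (ℚ._< + p / q) (sym (unit-fractions-sum x y)) (/-mono-< (x ℕ.+ y) (x ℕ.* y) p q {{ℕ.m*n≢0 x y}} lt)

sum≤⇒ : ∀ a b x y .{{_ : NonZero a}} .{{_ : NonZero b}} .{{_ : NonZero x}} .{{_ : NonZero y}} →
  + 1 / a + + 1 / b ℚ.≤ + 1 / x + + 1 / y → (a ℕ.+ b) ℕ.* (x ℕ.* y) ≤ (x ℕ.+ y) ℕ.* (a ℕ.* b)
sum≤⇒ a b x y le = /-cancel-≤ (a ℕ.+ b) (a ℕ.* b) (x ℕ.+ y) (x ℕ.* y) {{ℕ.m*n≢0 a b}} {{ℕ.m*n≢0 x y}}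
  (subst₂ ℚ._≤_ (unit-fractions-sum a b) (unit-fractions-sum x y) le)

-- For θ = s/t the hypothesis is t < n s, so the integer quotient of t by s is less than `n`. With
-- `1/G<θ`, this makes `G θ` the least admissible denominator.
G-least : ∀ θ .{{_ : Positive θ}} n .{{_ : NonZero n}} → + 1 / n ℚ.< θ → G θ ≤ n
G-least (mkℚ +[1+ k ] d _) (suc n) lt = subst (_< suc n) (sym (cong ∣_∣ (ℤ.div-pos-is-/ℕ +[1+ d ] (suc k))))
  (ℕ.m<n*o⇒m/o<n (ℤ.drop‿+<+ (subst₂ ℤ._<_ (ℤ.*-identityˡ +[1+ d ]) (ℤ.*-comm +[1+ k ] +[1+ n ])
    (ℚᵘ.drop-*<* (ℚᵘ.<-respˡ-≃ (ℚ.toℚᵘ-fromℚᵘ (mkℚᵘ (+ 1) n)) (ℚ.toℚᵘ-mono-< lt))))))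

+-cancel-remainder : ∀ s t → (s + t) ℚ.- s ≡ t
+-cancel-remainder s t = begin
  (s + t) ℚ.- s    ≡⟨ cong (ℚ._- s) (ℚ.+-comm s t) ⟩
  (t + s) ℚ.- s    ≡⟨ ℚ.+-assoc t s (ℚ.- s) ⟩
  t + (s ℚ.- s)    ≡⟨ cong (_+_ t) (ℚ.+-inverseʳ s) ⟩
  t + ℚ.0ℚ         ≡⟨ ℚ.+-identityʳ t ⟩
  t                ∎
  where open ≡-Reasoning

0<q-p⇒p<q : ∀ {p q} .{{_ : Positive (q ℚ.- p)}} → p ℚ.< q
0<q-p⇒p<q {p} {q} = subst₂ ℚ._<_ (ℚ.+-identityˡ p) regroup (ℚ.+-monoˡ-< p (ℚ.positive⁻¹ (q ℚ.- p)))
  where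
  regroup : q ℚ.- p + p ≡ q
  regroup = trans (ℚ.+-assoc q (ℚ.- p) p) (trans (cong (_+_ q) (ℚ.+-inverseˡ p)) (ℚ.+-identityʳ q))

-- The greedy terms of p/q and their uniqueness

module _ (p q : ℕ) .{{_ : NonZero p}} .{{_ : NonZero q}} where

  private
    θ = + p / q
    a = greedy θ 0
    b = greedy θ 1
    s = greedySum θ 0

  greedyPair : GreedyPair p q (greedy (+ p / q) 0) (greedy (+ p / q) 1)
  greedyPair = record
    { first-under  = subst (_< p ℕ.* a) (ℕ.*-identityˡ q) (/-cancel-< 1 a p q (1/G<θ θ))
    ; first-least  = first-least
    ; second-under = sum<⇒ a b p q (0<q-p⇒p<q {greedySum θ 1} {θ} {{greedy-remainder θ 1}})
    ; second-least = second-least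
    }
    where
    first-least : ∀ n → q < p ℕ.* n → a ≤ n
    first-least zero      lt = contradiction (subst (q <_) (ℕ.*-zeroʳ p) lt) ℕ.n≮0
    first-least n@(suc _) lt = G-least θ n (/-mono-< 1 n p q (subst (_< p ℕ.* n) (sym (ℕ.*-identityˡ q)) lt))

    second-least : ∀ n → (a ℕ.+ n) ℕ.* q < p ℕ.* (a ℕ.* n) → b ≤ n
    second-least zero      lt =
      contradiction (subst ((a ℕ.+ 0) ℕ.* q <_) (trans (cong (p ℕ.*_) (ℕ.*-zeroʳ a)) (ℕ.*-zeroʳ p)) lt) ℕ.n≮0
    second-least n@(suc _) lt = G-least (θ ℚ.- s) {{greedy-remainder θ 0}} n
      (subst (ℚ._< θ ℚ.- s) (+-cancel-remainder s (+ 1 / n))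
        (ℚ.+-monoˡ-< (ℚ.- s) {s + + 1 / n} {θ} (sum<⇐ a n p q lt)))

  challenger : p < q → p ℕ.* greedy (+ p / q) 0 ≤ q ℕ.+ 3 →
    ∀ x y .{{_ : NonZero x}} .{{_ : NonZero y}} → x ≤ y →
    greedySum (+ p / q) 1 ℚ.≤ + 1 / x + + 1 / y → + 1 / x + + 1 / y ℚ.< + p / q →
    (x ≡ greedy (+ p / q) 0 × y ≡ greedy (+ p / q) 1) ⊎ (p ≡ 10 × q ≡ 17 × x ≡ 3 × y ≡ 4)
  challenger p<q near x y x≤y beats under =
    dichotomy {p} {q} {a} {b} {x} {y} greedyPair p<q near x≤y (sum≤⇒ a b x y beats) (sum<⇒ x y p q under)

-- A sum not at most `s` is at least `s`, where the premise forces equality; commutativity lifts the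
-- restriction `x ≤ y`. Optimality thus follows from the analysis of challengers.
ties⇒≤ : ∀ θ s →
  (∀ x y .{{_ : NonZero x}} .{{_ : NonZero y}} → x ≤ y →
    s ℚ.≤ + 1 / x + + 1 / y → + 1 / x + + 1 / y ℚ.< θ → + 1 / x + + 1 / y ≡ s) →
  ∀ x y .{{_ : NonZero x}} .{{_ : NonZero y}} → + 1 / x + + 1 / y ℚ.< θ → + 1 / x + + 1 / y ℚ.≤ s
ties⇒≤ θ s ties x y under with ℚ.≤-total (+ 1 / x + + 1 / y) s | ℕ.≤-total x y
... | inj₁ fails | _        = fails
... | inj₂ beats | inj₁ x≤y = ℚ.≤-reflexive (ties x y x≤y beats under)
... | inj₂ beats | inj₂ y≤x = subst (ℚ._≤ s) swap
  (ℚ.≤-reflexive (ties y x y≤x (subst (s ℚ.≤_) (sym swap) beats) (subst (ℚ._< θ) (sym swap) under)))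
  where
  swap : + 1 / y + + 1 / x ≡ + 1 / x + + 1 / y
  swap = ℚ.+-comm (+ 1 / y) (+ 1 / x)

unit-fractions-cong : ∀ x y a b .{{_ : NonZero x}} .{{_ : NonZero y}} .{{_ : NonZero a}} .{{_ : NonZero b}} →
  x ≡ a × y ≡ b → + 1 / x + + 1 / y ≡ + 1 / a + + 1 / b
unit-fractions-cong x y a b (refl , refl) = refl

unique-best : ∀ p q .{{_ : NonZero p}} .{{_ : NonZero q}} → p < q → Υ p q ≤ 3 → + p / q ≢ + 10 / 17 →
  IsUniqueBestTwoTerm (+ p / q)
unique-best p q p<q Υ≤3 ≢10/17 =
  ties⇒≤ (+ p / q) (greedySum (+ p / q) 1)
    (λ x y x≤y beats under → unit-fractions-cong x y (greedy (+ p / q) 0) (greedy (+ p / q) 1) (unique x y x≤y beats under)) , unique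
  where
  near : p ℕ.* greedy (+ p / q) 0 ≤ q ℕ.+ 3
  -- `q + Υ p q` is a multiple `p * n` exceeding `q`, so minimality of the first greedy term bounds
  -- it by `n`.
  near = bound (Υ-exists p q) Υ≤3
    where
    bound : (υ : ∃[ m ] IsΥ p q m) → proj₁ υ ≤ 3 → p ℕ.* greedy (+ p / q) 0 ≤ q ℕ.+ 3
    bound (m , m≢0 , divides n q+m≡np , _) m≤3 = begin
      p ℕ.* greedy (+ p / q) 0  ≤⟨ ℕ.*-monoʳ-≤ p (GreedyPair.first-least (greedyPair p q) n q<pn) ⟩
      p ℕ.* n                   ≡⟨ q+m≡pn ⟨
      q ℕ.+ m                   ≤⟨ ℕ.+-monoʳ-≤ q m≤3 ⟩
      q ℕ.+ 3                   ∎
      where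
      open ℕ.≤-Reasoning
      q+m≡pn : q ℕ.+ m ≡ p ℕ.* n
      q+m≡pn = trans q+m≡np (ℕ.*-comm n p)
      q<pn : q < p ℕ.* n
      q<pn = subst (q <_) q+m≡pn (ℕ.m<m+n q (ℕ.>-nonZero⁻¹ m {{m≢0}}))

  unique : ∀ x y .{{_ : NonZero x}} .{{_ : NonZero y}} → x ≤ y →
    greedySum (+ p / q) 1 ℚ.≤ + 1 / x + + 1 / y → + 1 / x + + 1 / y ℚ.< + p / q →
    x ≡ greedy (+ p / q) 0 × y ≡ greedy (+ p / q) 1
  unique x y x≤y beats under = [ id , (λ { (p≡10 , q≡17 , _) → contradiction (ℚ./-cong (cong +_ p≡10) q≡17) ≢10/17 }) ]′
    (challenger p q p<q near x y x≤y beats under)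

-- The fraction 10/17

greedy-10/17-0 : greedy (+ 10 / 17) 0 ≡ 2
greedy-10/17-0 = refl

greedy-10/17-1 : greedy (+ 10 / 17) 1 ≡ 12
greedy-10/17-1 = refl

greedySum-10/17 : greedySum (+ 10 / 17) 1 ≡ + 7 / 12
greedySum-10/17 = refl

1/3+1/4<10/17 : + 1 / 3 + + 1 / 4 ℚ.< + 10 / 17
1/3+1/4<10/17 = toWitness {a? = + 1 / 3 + + 1 / 4 ℚ.<? + 10 / 17} tt

near-10/17 : 10 ℕ.* greedy (+ 10 / 17) 0 ≤ 17 ℕ.+ 3
near-10/17 = ℕ.≤-reflexive (cong (10 ℕ.*_) greedy-10/17-0)

challenger-10/17 : ∀ x y .{{_ : NonZero x}} .{{_ : NonZero y}} → x ≤ y →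
  + 7 / 12 ℚ.≤ + 1 / x + + 1 / y → + 1 / x + + 1 / y ℚ.< + 10 / 17 →
  (x ≡ 2 × y ≡ 12) ⊎ (x ≡ 3 × y ≡ 4)
challenger-10/17 x y x≤y beats under = Sum.map
  (λ { (x≡ , y≡) → trans x≡ greedy-10/17-0 , trans y≡ greedy-10/17-1 })
  (λ { (_ , _ , x≡3,y≡4) → x≡3,y≡4 })
  (challenger 10 17 (ℕ.m≤m+n 11 6) near-10/17 x y x≤y
    (subst (ℚ._≤ + 1 / x + + 1 / y) (sym greedySum-10/17) beats) under)

best-10/17 : IsBestTwoTerm (+ 10 / 17)
best-10/17 x y under = subst (+ 1 / x + + 1 / y ℚ.≤_) (sym greedySum-10/17) (ties⇒≤ (+ 10 / 17) (+ 7 / 12) ties x y under)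
  where
  ties : ∀ x y .{{_ : NonZero x}} .{{_ : NonZero y}} → x ≤ y →
    + 7 / 12 ℚ.≤ + 1 / x + + 1 / y → + 1 / x + + 1 / y ℚ.< + 10 / 17 → + 1 / x + + 1 / y ≡ + 7 / 12
  -- Both 1/2 + 1/12 and 1/3 + 1/4 evaluate to 7/12.
  ties x y x≤y beats under = [ unit-fractions-cong x y 2 12 , unit-fractions-cong x y 3 4 ]′
    (challenger-10/17 x y x≤y beats under)

not-unique-10/17 : ¬ IsUniqueBestTwoTerm (+ 10 / 17)
not-unique-10/17 (_ , unique) = contradiction (trans 3≡greedy greedy-10/17-0) λ ()
  where
  3≡greedy : 3 ≡ greedy (+ 10 / 17) 0
  3≡greedy = proj₁ (unique 3 4 (ℕ.n≤1+n 3) (ℚ.≤-reflexive greedySum-10/17) 1/3+1/4<10/17)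

tied-10/17 : ∀ x₁ x₂ .{{_ : NonZero x₁}} .{{_ : NonZero x₂}} → x₁ ≤ x₂ →
  (+ 1 / x₁ + + 1 / x₂ ℚ.< + 10 / 17 ×
   + 1 / x₁ + + 1 / x₂ ≡ + 1 / 2 + + 1 / 12 ×
   ¬ (x₁ ≡ 2 × x₂ ≡ 12))
  ⇔ (x₁ ≡ 3 × x₂ ≡ 4)
tied-10/17 x₁ x₂ x₁≤x₂ = mk⇔ only tied
  where
  only : + 1 / x₁ + + 1 / x₂ ℚ.< + 10 / 17 × + 1 / x₁ + + 1 / x₂ ≡ + 1 / 2 + + 1 / 12 × ¬ (x₁ ≡ 2 × x₂ ≡ 12) →
    x₁ ≡ 3 × x₂ ≡ 4
  only (under , eq , ≢[2,12]) =
    [ (λ same → contradiction same ≢[2,12]) , id ]′ (challenger-10/17 x₁ x₂ x₁≤x₂ (ℚ.≤-reflexive (sym eq)) under)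

  tied : x₁ ≡ 3 × x₂ ≡ 4 →
    + 1 / x₁ + + 1 / x₂ ℚ.< + 10 / 17 × + 1 / x₁ + + 1 / x₂ ≡ + 1 / 2 + + 1 / 12 × ¬ (x₁ ≡ 2 × x₂ ≡ 12)
  tied (x₁≡3 , x₂≡4) =
    subst (ℚ._< + 10 / 17) (sym (unit-fractions-cong x₁ x₂ 3 4 (x₁≡3 , x₂≡4))) 1/3+1/4<10/17 ,
    unit-fractions-cong x₁ x₂ 3 4 (x₁≡3 , x₂≡4) ,
    λ { (x₁≡2 , _) → contradiction (trans (sym x₁≡2) x₁≡3) λ () }

TiedBest : (θ : ℚ) .{{_ : Positive θ}} → Set
TiedBest θ = IsBestTwoTerm θ ×
  ¬ IsUniqueBestTwoTerm θ ×
  greedy θ 0 ≡ 2 × greedy θ 1 ≡ 12 ×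
  (∀ x₁ x₂ .{{_ : NonZero x₁}} .{{_ : NonZero x₂}} → x₁ ≤ x₂ →
    ((+ 1 / x₁ + + 1 / x₂ ℚ.< θ ×
      + 1 / x₁ + + 1 / x₂ ≡ + 1 / 2 + + 1 / 12 ×
      ¬ (x₁ ≡ 2 × x₂ ≡ 12))
    ⇔ (x₁ ≡ 3 × x₂ ≡ 4)))

-- In the theorem `p` and `q` need only be proportional to 10 and 17. A variable `θ` lets the
-- equation of rationals be matched.
tied-best : ∀ θ .{{_ : Positive θ}} → θ ≡ + 10 / 17 → TiedBest θ
tied-best θ refl = best-10/17 , not-unique-10/17 , greedy-10/17-0 , greedy-10/17-1 , tied-10/17

-- Failure of the greedy algorithm for every `k ≥ 4`

GreedyFails : ℕ → Set
GreedyFails k = ∃[ p ] ∃[ q ] Σ[ p≢0 ∈ NonZero p ] Σ[ q≢0 ∈ NonZero q ]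
  (p < q ×
   Υ p q {{p≢0}} ≡ k ×
   ¬ IsBestTwoTerm ((+ p / q) {{q≢0}}) {{/-positive {{p≢0}} {{q≢0}}}})

-- (a + n) X < Y a n says that 1/a + 1/n < Y/X, which is monotone in n.
steps-below : ∀ a s t X Y → (a ℕ.+ s) ℕ.* X < Y ℕ.* (a ℕ.* s) → Y ℕ.* (a ℕ.* t) ≤ (a ℕ.+ t) ℕ.* X → t < s
steps-below a s t X Y s-under t-over = ℕ.≰⇒> λ s≤t → ℕ.<⇒≱ (cross s≤t) (begin
  (a ℕ.+ t) ℕ.* X ℕ.* s                      ≡⟨ solve (a ∷ s ∷ t ∷ X ∷ []) ⟩
  a ℕ.* X ℕ.* s ℕ.+ s ℕ.* X ℕ.* t            ≤⟨ ℕ.+-monoˡ-≤ (s ℕ.* X ℕ.* t) (ℕ.*-monoʳ-≤ (a ℕ.* X) s≤t) ⟩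
  a ℕ.* X ℕ.* t ℕ.+ s ℕ.* X ℕ.* t            ≡⟨ solve (a ∷ s ∷ t ∷ X ∷ []) ⟩
  (a ℕ.+ s) ℕ.* X ℕ.* t                      ∎)
  where
  open ℕ.≤-Reasoning
  s≢0 : s ≢ 0
  s≢0 refl = ℕ.n≮0 (subst ((a ℕ.+ 0) ℕ.* X <_) (trans (cong (Y ℕ.*_) (ℕ.*-zeroʳ a)) (ℕ.*-zeroʳ Y)) s-under)
  cross : s ≤ t → (a ℕ.+ s) ℕ.* X ℕ.* t < (a ℕ.+ t) ℕ.* X ℕ.* s
  cross s≤t = begin-strict
    (a ℕ.+ s) ℕ.* X ℕ.* t      <⟨ ℕ.*-monoˡ-< t {{ℕ.>-nonZero (ℕ.<-≤-trans (ℕ.n≢0⇒n>0 s≢0) s≤t)}} s-under ⟩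
    Y ℕ.* (a ℕ.* s) ℕ.* t      ≡⟨ solve (Y ∷ a ∷ s ∷ t ∷ []) ⟩
    Y ℕ.* (a ℕ.* t) ℕ.* s      ≤⟨ ℕ.*-monoˡ-≤ s t-over ⟩
    (a ℕ.+ t) ℕ.* X ℕ.* s      ∎

-- The hypotheses give p A ≤ q < p (A + 1), with `k` the distance to the upper end. So p (A + 1) is
-- the least multiple of `p` above `q`, which determines both `Υ p q` and the first greedy term.
module _ (p q k A : ℕ) .{{_ : NonZero p}} .{{_ : NonZero q}} (1≤k : 1 ≤ k)
  (q+k≡p[1+A] : q ℕ.+ k ≡ p ℕ.* suc A) (pA≤q : p ℕ.* A ≤ q) where

  q<pn⇒A<n : ∀ n → q < p ℕ.* n → A < n
  q<pn⇒A<n n q<pn = ℕ.*-cancelˡ-< p A n (ℕ.≤-<-trans pA≤q q<pn)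

  Υ≡k : Υ p q ≡ k
  Υ≡k = ≡k (Υ-exists p q)
    where
    ≡k : (υ : ∃[ m ] IsΥ p q m) → proj₁ υ ≡ k
    ≡k (m , m≢0 , divides n q+m≡np , least) = ℕ.≤-antisym
      (least k (ℕ.>-nonZero 1≤k) (divides (suc A) (trans q+k≡p[1+A] (ℕ.*-comm p (suc A)))))
      (ℕ.+-cancelˡ-≤ q k m (begin
        q ℕ.+ k      ≡⟨ q+k≡p[1+A] ⟩
        p ℕ.* suc A  ≤⟨ ℕ.*-monoʳ-≤ p (q<pn⇒A<n n (subst (q <_) q+m≡pn (ℕ.m<m+n q (ℕ.>-nonZero⁻¹ m {{m≢0}})))) ⟩
        p ℕ.* n      ≡⟨ q+m≡pn ⟨
        q ℕ.+ m      ∎))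
      where
      open ℕ.≤-Reasoning
      q+m≡pn : q ℕ.+ m ≡ p ℕ.* n
      q+m≡pn = trans q+m≡np (ℕ.*-comm n p)

  greedy₀≡1+A : greedy (+ p / q) 0 ≡ suc A
  greedy₀≡1+A = ℕ.≤-antisym
    (first-least (suc A) (subst (q <_) q+k≡p[1+A] (ℕ.m<m+n q 1≤k)))
    (q<pn⇒A<n (greedy (+ p / q) 0) first-under)
    where open GreedyPair (greedyPair p q)

  -- The denominator `B` is too small, so `b > B`. Were greedy best, 1/x + 1/y would be at most 1/(A
  -- + 1) + 1/b; as it exceeds 1/(A + 1) + 1/(B + 1), this would force `b ≤ B`.
  not-best : ∀ B x y .{{_ : NonZero x}} .{{_ : NonZero y}} →
    p ℕ.* (suc A ℕ.* B) ≤ (suc A ℕ.+ B) ℕ.* q → (x ℕ.+ y) ℕ.* q < p ℕ.* (x ℕ.* y) →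
    (suc A ℕ.+ suc B) ℕ.* (x ℕ.* y) < (x ℕ.+ y) ℕ.* (suc A ℕ.* suc B) →
    ¬ IsBestTwoTerm (+ p / q)
  not-best B x y B-over under beats best = ℕ.<⇒≱ b≤B B<b
    where
    a b : ℕ
    a = greedy (+ p / q) 0
    b = greedy (+ p / q) 1

    B<b : B < b
    B<b = steps-below (suc A) b B q p
      (subst (λ a → (a ℕ.+ b) ℕ.* q < p ℕ.* (a ℕ.* b)) greedy₀≡1+A (GreedyPair.second-under (greedyPair p q))) B-over

    b≤B : b < suc B
    b≤B = steps-below (suc A) (suc B) b (x ℕ.* y) (x ℕ.+ y) beats
      (subst (λ a → (x ℕ.+ y) ℕ.* (a ℕ.* b) ≤ (a ℕ.+ b) ℕ.* (x ℕ.* y)) greedy₀≡1+A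
        (sum≤⇒ x y a b (best x y (sum<⇐ x y p q under))))

  greedy-fails-at : ∀ B x y .{{_ : NonZero x}} .{{_ : NonZero y}} → p < q →
    p ℕ.* (suc A ℕ.* B) ≤ (suc A ℕ.+ B) ℕ.* q → (x ℕ.+ y) ℕ.* q < p ℕ.* (x ℕ.* y) →
    (suc A ℕ.+ suc B) ℕ.* (x ℕ.* y) < (x ℕ.+ y) ℕ.* (suc A ℕ.* suc B) →
    GreedyFails k
  greedy-fails-at B x y p<q B-over under beats =
    p , q , ℕ.≢-nonZero (ℕ.≢-nonZero⁻¹ p) , ℕ.≢-nonZero (ℕ.≢-nonZero⁻¹ q) , p<q , Υ≡k , not-best B x y B-over under beats

-- For 5e < k ≤ 9e the fraction (2k + e) / (5k + 3e) lies in (11/28, 19/48], where greedy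
-- gives 1/3 + 1/17, which is less than 1/4 + 1/7 = 11/28.
greedy-fails-family : ∀ k e → 5 ℕ.* e < k → k ≤ 9 ℕ.* e → GreedyFails k
greedy-fails-family k@(suc _) e 5e<k k≤9e =
  greedy-fails-at (2 ℕ.* k ℕ.+ e) (5 ℕ.* k ℕ.+ 3 ℕ.* e) k 2 (s≤s z≤n) (total k) (A-over k)
    -- `B = 16` comes from 19/48 = 1/3 + 1/16. The last argument is 20 * 28 = 560 < 561 = 11 * 51,
    -- that is, 1/3 + 1/17 < 1/4 + 1/7.
    16 4 7 (below k) (B-over k k≤9e) (under k 5e<k) (ℕ.≤-refl {561})
  where
  open ℕ.≤-Reasoning
  total : ∀ k → 5 ℕ.* k ℕ.+ 3 ℕ.* e ℕ.+ k ≡ (2 ℕ.* k ℕ.+ e) ℕ.* 3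
  total k = solve (k ∷ e ∷ [])
  A-over : ∀ k → (2 ℕ.* k ℕ.+ e) ℕ.* 2 ≤ 5 ℕ.* k ℕ.+ 3 ℕ.* e
  A-over k = begin
    (2 ℕ.* k ℕ.+ e) ℕ.* 2                      ≤⟨ ℕ.m≤m+n _ (k ℕ.+ e) ⟩
    (2 ℕ.* k ℕ.+ e) ℕ.* 2 ℕ.+ (k ℕ.+ e)        ≡⟨ solve (k ∷ e ∷ []) ⟩
    5 ℕ.* k ℕ.+ 3 ℕ.* e                        ∎
  below : ∀ k .{{_ : NonZero k}} → 2 ℕ.* k ℕ.+ e < 5 ℕ.* k ℕ.+ 3 ℕ.* e
  below k = begin-strict
    2 ℕ.* k ℕ.+ e                              <⟨ ℕ.m<m+n _ (ℕ.>-nonZero⁻¹ k) ⟩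
    2 ℕ.* k ℕ.+ e ℕ.+ k                        ≤⟨ ℕ.m≤m+n _ (2 ℕ.* (k ℕ.+ e)) ⟩
    2 ℕ.* k ℕ.+ e ℕ.+ k ℕ.+ 2 ℕ.* (k ℕ.+ e)    ≡⟨ solve (k ∷ e ∷ []) ⟩
    5 ℕ.* k ℕ.+ 3 ℕ.* e                        ∎
  B-over : ∀ k → k ≤ 9 ℕ.* e → (2 ℕ.* k ℕ.+ e) ℕ.* 48 ≤ 19 ℕ.* (5 ℕ.* k ℕ.+ 3 ℕ.* e)
  B-over k k≤9e = begin
    (2 ℕ.* k ℕ.+ e) ℕ.* 48                       ≡⟨ solve (k ∷ e ∷ []) ⟩
    95 ℕ.* k ℕ.+ 48 ℕ.* e ℕ.+ k                  ≤⟨ ℕ.+-monoʳ-≤ (95 ℕ.* k ℕ.+ 48 ℕ.* e) k≤9e ⟩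
    95 ℕ.* k ℕ.+ 48 ℕ.* e ℕ.+ 9 ℕ.* e            ≡⟨ solve (k ∷ e ∷ []) ⟩
    19 ℕ.* (5 ℕ.* k ℕ.+ 3 ℕ.* e)                 ∎
  under : ∀ k → 5 ℕ.* e < k → 11 ℕ.* (5 ℕ.* k ℕ.+ 3 ℕ.* e) < (2 ℕ.* k ℕ.+ e) ℕ.* 28
  under k 5e<k = begin-strict
    11 ℕ.* (5 ℕ.* k ℕ.+ 3 ℕ.* e)                 ≡⟨ solve (k ∷ e ∷ []) ⟩
    55 ℕ.* k ℕ.+ 28 ℕ.* e ℕ.+ 5 ℕ.* e            <⟨ ℕ.+-monoʳ-< (55 ℕ.* k ℕ.+ 28 ℕ.* e) 5e<k ⟩
    55 ℕ.* k ℕ.+ 28 ℕ.* e ℕ.+ k                  ≡⟨ solve (k ∷ e ∷ []) ⟩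
    (2 ℕ.* k ℕ.+ e) ℕ.* 28                       ∎

-- For 5/11 greedy gives 1/3 + 1/9 = 4/9, below 1/4 + 1/5 = 9/20.
greedy-fails-4 : GreedyFails 4
greedy-fails-4 = greedy-fails-at 5 11 4 2 (ℕ.≤ᵇ⇒≤ _ _ tt) refl (ℕ.≤ᵇ⇒≤ _ _ tt)
  8 4 5 (ℕ.≤ᵇ⇒≤ _ _ tt) (ℕ.≤ᵇ⇒≤ _ _ tt) (ℕ.≤ᵇ⇒≤ _ _ tt) (ℕ.≤ᵇ⇒≤ _ _ tt)

-- As 11/50 equals 1/5 + 1/50, strictness pushes greedy to 1/5 + 1/51, below 1/7 + 1/13.
greedy-fails-5 : GreedyFails 5
greedy-fails-5 = greedy-fails-at 11 50 5 4 (ℕ.≤ᵇ⇒≤ _ _ tt) refl (ℕ.≤ᵇ⇒≤ _ _ tt)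
  50 7 13 (ℕ.≤ᵇ⇒≤ _ _ tt) (ℕ.≤ᵇ⇒≤ _ _ tt) (ℕ.≤ᵇ⇒≤ _ _ tt) (ℕ.≤ᵇ⇒≤ _ _ tt)

-- For 11/45 greedy gives 1/5 + 1/23 = 28/115, below 1/6 + 1/13 = 19/78.
greedy-fails-10 : GreedyFails 10
greedy-fails-10 = greedy-fails-at 11 45 10 4 (ℕ.≤ᵇ⇒≤ _ _ tt) refl (ℕ.≤ᵇ⇒≤ _ _ tt)
  22 6 13 (ℕ.≤ᵇ⇒≤ _ _ tt) (ℕ.≤ᵇ⇒≤ _ _ tt) (ℕ.≤ᵇ⇒≤ _ _ tt) (ℕ.≤ᵇ⇒≤ _ _ tt)

-- The family covers 6 to 9 with `e = 1` and starts at 11 with `e = 2`; 4, 5 and 10 fall outside.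
5e<k≤9e⊎exceptional : ∀ k → 4 ≤ k → k < 11 → k ≡ 4 ⊎ k ≡ 5 ⊎ k ≡ 10 ⊎ (5 < k × k ≤ 9)
5e<k≤9e⊎exceptional k 4≤k k<11 = toWitness {a? = ℕ.allUpTo? (λ k → (4 ℕ.≤? k) →-dec
  ((k ℕ.≟ 4) ⊎-dec (k ℕ.≟ 5) ⊎-dec (k ℕ.≟ 10) ⊎-dec ((5 ℕ.<? k) ×-dec (k ℕ.≤? 9)))) 11} tt k<11 4≤k

-- The choice `e = j / 5` gives 5 e < j + 1 ≤ 5 e + 5, and 5 e + 5 ≤ 9 e once `e ≥ 2`, which
-- `10 ≤ j` secures.
greedy-fails-large : ∀ j → 10 ≤ j → GreedyFails (suc j)
greedy-fails-large j 10≤j = greedy-fails-family (suc j) e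
  (s≤s (subst (_≤ j) (ℕ.*-comm e 5) (ℕ.m/n*n≤m j 5)))
  (begin
    suc j                        ≡⟨ cong suc (ℕ.m≡m%n+[m/n]*n j 5) ⟩
    suc (j ℕ.% 5) ℕ.+ e ℕ.* 5    ≤⟨ ℕ.+-monoˡ-≤ (e ℕ.* 5) (ℕ.m%n<n j 5) ⟩
    5 ℕ.+ e ℕ.* 5                ≤⟨ ℕ.+-monoˡ-≤ (e ℕ.* 5) (ℕ.≤-trans (ℕ.m≤m+n 5 3) (ℕ.*-monoˡ-≤ 4 (ℕ./-monoˡ-≤ 5 10≤j))) ⟩
    e ℕ.* 4 ℕ.+ e ℕ.* 5          ≡⟨ ℕ.*-distribˡ-+ e 4 5 ⟨
    e ℕ.* 9                      ≡⟨ ℕ.*-comm e 9 ⟩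
    9 ℕ.* e                      ∎)
  where
  open ℕ.≤-Reasoning
  e : ℕ
  e = j ℕ./ 5

greedy-fails-small : ∀ {k} → k ≡ 4 ⊎ k ≡ 5 ⊎ k ≡ 10 ⊎ (5 < k × k ≤ 9) → GreedyFails k
greedy-fails-small (inj₁ refl)                           = greedy-fails-4
greedy-fails-small (inj₂ (inj₁ refl))                    = greedy-fails-5
greedy-fails-small (inj₂ (inj₂ (inj₁ refl)))             = greedy-fails-10
greedy-fails-small {k} (inj₂ (inj₂ (inj₂ (5<k , k≤9))))  = greedy-fails-family k 1 5<k k≤9

greedy-fails : ∀ k → 4 ≤ k → GreedyFails k
greedy-fails k@(suc j) 4≤k = [ (λ k<11 → greedy-fails-small (5e<k≤9e⊎exceptional k 4≤k k<11))
                             , (λ 11≤k → greedy-fails-large j (ℕ.s≤s⁻¹ 11≤k)) ]′ (ℕ.<-≤-connex k 11)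

theorem1p3 : (∀ p q .{{_ : NonZero p}} .{{_ : NonZero q}} → p < q →
    (Υ p q ≤ 3 → + p / q ≢ + 10 / 17 → IsUniqueBestTwoTerm (+ p / q)) ×
    (+ p / q ≡ + 10 / 17 →
    IsBestTwoTerm (+ p / q) ×
    ¬ IsUniqueBestTwoTerm (+ p / q) ×
    greedy (+ p / q) 0 ≡ 2 × greedy (+ p / q) 1 ≡ 12 ×
    (∀ x₁ x₂ .{{_ : NonZero x₁}} .{{_ : NonZero x₂}} → x₁ ≤ x₂ →
    ((+ 1 / x₁ + + 1 / x₂ ℚ.< + p / q ×
    + 1 / x₁ + + 1 / x₂ ≡ + 1 / 2 + + 1 / 12 ×
    ¬ (x₁ ≡ 2 × x₂ ≡ 12))
    ⇔ (x₁ ≡ 3 × x₂ ≡ 4))))) ×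
    (∀ k → 4 ≤ k →
    ∃[ p ] ∃[ q ] Σ[ p≢0 ∈ NonZero p ] Σ[ q≢0 ∈ NonZero q ]
    (p < q ×
    Υ p q {{p≢0}} ≡ k ×
    ¬ IsBestTwoTerm ((+ p / q) {{q≢0}}) {{/-positive {{p≢0}} {{q≢0}}}}))
theorem1p3 = (λ p q p<q → unique-best p q p<q , tied-best (+ p / q)) , greedy-fails
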